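{- For the single round Bad Santa problem on streams of length $n$, the optimal expected number of queries is $\Theta(\sqrt{n})$ as $n\to\infty$. That is, if $Q(n)$ denotes the infimum, over all randomized streaming algorithms that find a $1$ with probability $1$ on every valid input, of the maximum over valid inputs of the expected number of queries, then $Q(n)=\Theta(\sqrt{n})$.
   Context: Bad Santa problem, single round: the input is a string $b\in\{0,1\}^n$ in which at least half of the $n$ bits are $1$ (a valid input). The bits stream by in the order $b_1,b_2,\dots,b_n$. When a bit passes, the algorithm decides immediately whether to query it (at cost $1$, learning its value); a bit that is not queried when it passes is lost. The algorithm must query some bit whose value is $1$, and stops as soon as it does so. The algorithm may be randomized; it is required to be Las Vegas, i.e. on every valid input it finds a $1$ with probability $1$. Inputs are chosen by an adversary who knows the algorithm but not its random choices: the input is fixed in advance, the expectation is over the algorithm's randomness, and the cost of an algorithm is the maximum over valid inputs of its expected number of queries. -}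

module Defs where

open import Algebra.Bundles.Raw using (RawMonoid)
import Algebra.Definitions.RawMonoid
open import Data.Bool using (Bool; true; false; if_then_else_; _≟_)
open import Data.Fin using (Fin)
import Data.Integer as ℤ
open import Data.Nat as ℕ using (ℕ; suc; _⊔_)
import Data.Nat.Properties as ℕ
open import Data.Product using (∃-syntax; _×_; _,_)
open import Data.Rational
  using (ℚ; 0ℚ; 1ℚ; ½; _+_; _-_; -_; _*_; _/_; _≤_; _<_; ∣_∣)
open import Data.Rational.Properties
  using ( +-mono-<; ≤-<-trans; ∣p+q∣≤∣p∣+∣q∣; +-assoc; +-comm; neg-distrib-+
        ; *-distribˡ-+; *-identityʳ; *-monoˡ-<-pos; +-inverseʳ )
open import Data.Vec using (Vec; []; _∷_; count)
open import Relation.Binary.PropositionalEquality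
  using (_≡_; sym; trans; cong; subst; subst₂)

------------------------------------------------------------------------
-- Real numbers: Cauchy sequences of rationals, compared up to _≈ᵣ_

Eventually : (ℕ → Set) → Set
Eventually P = ∃[ N ] (∀ n → N ℕ.≤ n → P n)

record ℝ : Set where
  field
    seq    : ℕ → ℚ
    cauchy : ∀ ε → 0ℚ < ε →
             ∃[ N ] (∀ m n → N ℕ.≤ m → N ℕ.≤ n → ∣ seq m - seq n ∣ < ε)

open ℝ public

infix 4 _≤ᵣ_ _≈ᵣ_
infixl 6 _+ᵣ_

_≤ᵣ_ : ℝ → ℝ → Set
x ≤ᵣ y = ∀ ε → 0ℚ < ε → Eventually λ n → seq x n ≤ seq y n + ε

_≈ᵣ_ : ℝ → ℝ → Set
x ≈ᵣ y = (x ≤ᵣ y) × (y ≤ᵣ x)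

fromℚ : ℚ → ℝ
fromℚ q = record
  { seq    = λ _ → q
  ; cauchy = λ ε 0<ε → 0 , λ _ _ _ _ →
      subst (_< ε) (sym (cong ∣_∣ (+-inverseʳ q))) 0<ε
  }

0ᵣ 1ᵣ : ℝ
0ᵣ = fromℚ 0ℚ
1ᵣ = fromℚ 1ℚ

private
  interchange : ∀ a b c d → (a + b) + (c + d) ≡ (a + c) + (b + d)
  interchange a b c d =
    trans (+-assoc a b (c + d))
    (trans (cong (a +_) (trans (sym (+-assoc b c d))
                        (trans (cong (_+ d) (+-comm b c)) (+-assoc c b d))))
           (sym (+-assoc a c (b + d))))

  difference-+ : ∀ a b c d → (a + b) - (c + d) ≡ (a - c) + (b - d)
  difference-+ a b c d =
    trans (cong (a + b +_) (neg-distrib-+ c d)) (interchange a b (- c) (- d))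

  halves : ∀ ε → ε * ½ + ε * ½ ≡ ε
  halves ε = trans (sym (*-distribˡ-+ ε ½ ½)) (*-identityʳ ε)

  half-positive : ∀ ε → 0ℚ < ε → 0ℚ < ε * ½
  half-positive ε 0<ε = *-monoˡ-<-pos ½ 0<ε

_+ᵣ_ : ℝ → ℝ → ℝ
seq    (x +ᵣ y) n = seq x n + seq y n
cauchy (x +ᵣ y) ε 0<ε =
  let M , close-x = cauchy x (ε * ½) (half-positive ε 0<ε)
      N , close-y = cauchy y (ε * ½) (half-positive ε 0<ε)
  in M ⊔ N , λ m n M⊔N≤m M⊔N≤n →
    subst₂ _<_
      (cong ∣_∣ (sym (difference-+ (seq x m) (seq y m) (seq x n) (seq y n))))
      (halves ε)
      (≤-<-trans (∣p+q∣≤∣p∣+∣q∣ (seq x m - seq x n) (seq y m - seq y n))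
        (+-mono-<
          (close-x m n (ℕ.m⊔n≤o⇒m≤o M N M⊔N≤m) (ℕ.m⊔n≤o⇒m≤o M N M⊔N≤n))
          (close-y m n (ℕ.m⊔n≤o⇒n≤o M N M⊔N≤m) (ℕ.m⊔n≤o⇒n≤o M N M⊔N≤n))))

+ᵣ-0ᵣ-rawMonoid : RawMonoid _ _
+ᵣ-0ᵣ-rawMonoid = record { Carrier = ℝ ; _≈_ = _≈ᵣ_ ; _∙_ = _+ᵣ_ ; ε = 0ᵣ }

module ℝ-Sum = Algebra.Definitions.RawMonoid +ᵣ-0ᵣ-rawMonoid

------------------------------------------------------------------------
-- Upper reals: an element x of (-∞, +∞] is given by its strict upper cut
-- { q ∈ ℚ | x < q }.  The cut of an infimum is the union of the cuts (the
-- infimum of the empty family is +∞), and the cut of a maximum of finitely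
-- many reals is the intersection of the cuts.

UpperReal : Set₁
UpperReal = ℚ → Set

infix 4 _≤ᵘ_
infixr 7 _·ᵘ_

_≤ᵘ_ : UpperReal → UpperReal → Set
x ≤ᵘ y = ∀ q → y q → x q

upper : ℝ → UpperReal
upper x q = ∃[ r ] (r < q × Eventually λ n → seq x n ≤ r)

inf : {I : Set} → (I → UpperReal) → UpperReal
inf {I} x q = ∃[ i ] x i q

-- Meaningful for c > 0 only.
_·ᵘ_ : ℚ → UpperReal → UpperReal
(c ·ᵘ x) q = ∃[ r ] (x r × c * r ≤ q)

√ : ℕ → UpperReal
√ n q = 0ℚ < q × (ℤ.+ n) / 1 < q * q

IsΘ : (ℕ → UpperReal) → (ℕ → UpperReal) → Set
IsΘ f g =
  ∃[ c ] ∃[ C ] (0ℚ < c × 0ℚ < C ×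
    ∃[ N ] (∀ n → N ℕ.≤ n → (c ·ᵘ g n ≤ᵘ f n) × (f n ≤ᵘ C ·ᵘ g n)))

------------------------------------------------------------------------
-- The single round problem; true is the bit 1

Valid : ∀ {n} → Vec Bool n → Set
Valid {n} b = n ℕ.≤ 2 ℕ.* count (_≟ true) b

-- A deterministic algorithm for the next n bits of the stream.  A run ends
-- as soon as a query returns 1, so a query is continued only after answer 0.
data Algorithm : ℕ → Set where
  end   : Algorithm 0
  skip  : ∀ {n} → Algorithm n → Algorithm (suc n)
  query : ∀ {n} → Algorithm n → Algorithm (suc n)

finds : ∀ {n} → Algorithm n → Vec Bool n → Bool
finds end       []          = false
finds (skip A)  (_ ∷ b)     = finds A b
finds (query A) (true ∷ b)  = true
finds (query A) (false ∷ b) = finds A b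

queries : ∀ {n} → Algorithm n → Vec Bool n → ℕ
queries end       []          = 0
queries (skip A)  (_ ∷ b)     = queries A b
queries (query A) (true ∷ b)  = 1
queries (query A) (false ∷ b) = suc (queries A b)

-- A randomized algorithm is a random deterministic algorithm, fixed before
-- the stream is read.  There are finitely many deterministic algorithms for
-- each n, so a finite sample space with real weights is fully general.
record RandomizedAlgorithm (n : ℕ) : Set where
  field
    size       : ℕ
    weight     : Fin size → ℝ
    weight≥0   : ∀ ω → 0ᵣ ≤ᵣ weight ω
    weight-sum : ℝ-Sum.sum weight ≈ᵣ 1ᵣ
    algorithm  : Fin size → Algorithm n

  𝔼 : (Fin size → ℕ) → ℝ
  𝔼 X = ℝ-Sum.sum λ ω → X ω ℝ-Sum.× weight ω

  ℙ : (Fin size → Bool) → ℝ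
  ℙ e = 𝔼 λ ω → if e ω then 1 else 0

  ℙ-finds : Vec Bool n → ℝ
  ℙ-finds b = ℙ λ ω → finds (algorithm ω) b

  𝔼-queries : Vec Bool n → ℝ
  𝔼-queries b = 𝔼 λ ω → queries (algorithm ω) b

record LasVegasAlgorithm (n : ℕ) : Set where
  field
    randomized : RandomizedAlgorithm n

  open RandomizedAlgorithm randomized public

  field
    alwaysFinds : ∀ b → Valid b → ℙ-finds b ≈ᵣ 1ᵣ

  -- The maximum of 𝔼-queries over the (finitely many) valid inputs.
  cost : UpperReal
  cost q = ∀ b → Valid b → upper (𝔼-queries b) q

Q : ℕ → UpperReal
Q n = inf (LasVegasAlgorithm.cost {n})

-- Upper bound: with s ≈ √n, query each of the first (n − 1) / 2 bits
-- independently with probability 1 / s, and then every remaining bit.  If the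
-- first half contains k ones, the second half starts with at most k + 1 zeros,
-- and k (1 − 1 / s)ᵏ ≤ s, so O(√n) queries are expected.
--
-- Lower bound: with m ≈ √n / 2, take the 2m inputs with a block of m ones in one
-- of 2m disjoint places of the first n / 2 + m bits, followed by ones.  A correct
-- algorithm skips at most n / 2 bits, as otherwise the input with ones exactly at
-- the skipped bits defeats it.  So it reads at least m of the first n / 2 + m
-- bits, and each of these reads eliminates at most one of the inputs.

module Submission where

open import Defs
open import Algebra.Bundles using (module CommutativeMonoid)
import Algebra.Properties.CommutativeMonoid.Mult as Mult
import Algebra.Properties.CommutativeMonoid.Sum as Sum
import Algebra.Properties.CommutativeSemigroup as CommutativeSemigroup
open import Data.Bool using (Bool; true; false; not; if_then_else_)
open import Data.Empty using (⊥-elim)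
open import Data.Fin using (Fin; zero; suc)
import Data.Integer as ℤ
import Data.Integer.Properties as ℤ
open import Data.List using (List; []; _∷_; length; map; lookup)
open import Data.List.Membership.Propositional.Properties using (∈-lookup)
open import Data.List.Relation.Unary.All as All using (All; []; _∷_)
open import Data.Nat as ℕ using (ℕ; zero; suc; z≤n; s≤s; s≤s⁻¹; NonZero)
import Data.Nat.Properties as ℕ
open import Data.Nat.Tactic.RingSolver using (solve-∀)
open import Data.Product using (∃-syntax; _×_; _,_; proj₁; proj₂)
open import Data.Sum using (_⊎_; inj₁; inj₂)
open import Data.Vec using (Vec)
open import Function using (_∘_)
open import Relation.Binary.PropositionalEquality
open import Relation.Nullary using (yes; no)

-- Deterministic algorithms

module Deterministic where

  open import Data.Bool using (_∧_; _≟_)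
  open import Data.List as List using (concat)
  open import Data.List.Properties using (map-++; map-∘; length-map)
  import Data.List.Relation.Unary.All.Properties as All
  open import Data.List.Relation.Unary.AllPairs as AllPairs using (AllPairs; []; _∷_)
  import Data.List.Relation.Unary.AllPairs.Properties as AllPairs
  open import Data.Nat using (_+_; _*_; _^_; _∸_; _≤_; _<_; _≤?_; _<?_; ⌊_/2⌋; >-nonZero⁻¹)
  open import Data.Nat.ListAction using (sum)
  open import Data.Nat.ListAction.Properties using (sum-++)
  open import Data.Nat.Properties hiding (_≟_; _≤?_; _<?_)
  open CommutativeSemigroup +-commutativeSemigroup using (x∙yz≈y∙xz)
  open import Data.Vec using ([]; _∷_; _++_; replicate; count; tail)
  open import Data.Vec.Properties using (count≤n)
  open import Data.Vec.Relation.Binary.Pointwise.Inductive as Pointwise using (Pointwise; []; _∷_)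

  -- Halves and square roots of natural numbers

  halve : ∀ n → ∃[ h ] (2 * h ≤ n × n ≤ suc (2 * h))
  halve n = ⌊ n /2⌋ ,
    subst (_≤ n) (cong (⌊ n /2⌋ +_) (sym (+-identityʳ _)))
      (subst (⌊ n /2⌋ + ⌊ n /2⌋ ≤_) (⌊n/2⌋+⌈n/2⌉≡n n) (+-monoʳ-≤ ⌊ n /2⌋ (⌊n/2⌋≤⌈n/2⌉ n))) ,
    upper-half n
    where
    upper-half : ∀ n → n ≤ suc (2 * ⌊ n /2⌋)
    upper-half zero          = z≤n
    upper-half (suc zero)    = s≤s z≤n
    upper-half (suc (suc n)) = subst (suc (suc n) ≤_) (lemma ⌊ n /2⌋) (s≤s (s≤s (upper-half n)))
      where
      lemma : ∀ x → 3 + 2 * x ≡ 1 + 2 * (1 + x)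
      lemma = solve-∀

  -- Induction on `n`: once `suc n` reaches the square of `d * suc m` the root moves to `suc m`, and
  -- one move suffices because `n` was still below that square. The lower bound takes `d = 2`, the
  -- upper bound `d = 1`.
  integerRoot : ∀ d .{{_ : NonZero d}} n → ∃[ m ] (d * m * (d * m) ≤ n × n < d * suc m * (d * suc m))
  integerRoot d zero = 0 , ≤-reflexive (cong₂ _*_ (*-zeroʳ d) (*-zeroʳ d)) ,
    >-nonZero⁻¹ _ {{m*n≢0 _ _ {{m*n≢0 d 1}} {{m*n≢0 d 1}}}}
  integerRoot d (suc n) with integerRoot d n
  ... | m , lo , hi with suc n <? d * suc m * (d * suc m)
  ...   | yes p = m , m≤n⇒m≤1+n lo , p
  ...   | no ¬p = suc m , ≮⇒≥ ¬p , ≤-<-trans hi (*-mono-< dm< dm<)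
    where
    dm< : d * suc m < d * suc (suc m)
    dm< = *-monoʳ-< d (n<1+n (suc m))

  -- Counting ones, and the input on which every query fails

  ones : ∀ {n} → Vec Bool n → ℕ
  ones = count (_≟ true)

  -- ones (avoid A) is the number of bits that A skips while every answer is 0.
  avoid : ∀ {n} → Algorithm n → Vec Bool n
  avoid end       = []
  avoid (skip A)  = true ∷ avoid A
  avoid (query A) = false ∷ avoid A

  -- Every queried bit is 0 and every 1 is skipped. Hence if `avoid A` is valid, `A` must have
  -- probability zero in a Las Vegas algorithm.
  finds-avoid : ∀ {n} (A : Algorithm n) → finds A (avoid A) ≡ false
  finds-avoid end       = refl
  finds-avoid (skip A)  = finds-avoid A
  finds-avoid (query A) = finds-avoid A

  -- Sums over lists

  total : ∀ {a} {A : Set a} → (A → ℕ) → List A → ℕ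
  total f xs = sum (map f xs)

  module _ {a} {A : Set a} where

    total-++ : ∀ (f : A → ℕ) xs ys → total f (xs List.++ ys) ≡ total f xs + total f ys
    total-++ f xs ys = trans (cong sum (map-++ f xs ys)) (sum-++ (map f xs) (map f ys))

    total-replicate : ∀ (f : A → ℕ) t xs → total f (concat (List.replicate t xs)) ≡ t * total f xs
    total-replicate f zero    xs = refl
    total-replicate f (suc t) xs = trans (total-++ f xs _) (cong (total f xs +_) (total-replicate f t xs))

    total-suc : ∀ (f : A → ℕ) xs → total (suc ∘ f) xs ≡ length xs + total f xs
    total-suc f []       = refl
    total-suc f (x ∷ xs) = cong suc (trans (cong (f x +_) (total-suc f xs)) (x∙yz≈y∙xz (f x) (length xs) _))

    total-1 : ∀ (xs : List A) → total (λ _ → 1) xs ≡ length xs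
    total-1 []       = refl
    total-1 (x ∷ xs) = cong suc (total-1 xs)

    total-map : ∀ {b} {B : Set b} (f : A → ℕ) (g : B → A) xs → total f (map g xs) ≡ total (f ∘ g) xs
    total-map f g xs = cong sum (sym (map-∘ xs))

  -- Queries spent on pairwise disjoint inputs

  Disjoint : ∀ {n} → Vec Bool n → Vec Bool n → Set
  Disjoint = Pointwise λ x y → x ∧ y ≡ false

  -- What remains of a list of inputs after a query: on inputs that answer 1 the run is over, the
  -- others lose their first bit.
  alive : ∀ {n} → List (Vec Bool (suc n)) → List (Vec Bool n)
  alive []                 = []
  alive ((true  ∷ b) ∷ bs) = alive bs
  alive ((false ∷ b) ∷ bs) = b ∷ alive bs

  disjoint-alive : ∀ {n x} {b : Vec Bool n} {bs} →
                   All (Disjoint (x ∷ b)) bs → All (Disjoint b) (alive bs)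
  disjoint-alive []                                   = []
  disjoint-alive {bs = (true  ∷ _) ∷ _} (_ ∷ ds)       = disjoint-alive ds
  disjoint-alive {bs = (false ∷ _) ∷ _} ((_ ∷ d) ∷ ds) = d ∷ disjoint-alive ds

  allPairs-alive : ∀ {n} {bs : List (Vec Bool (suc n))} →
                   AllPairs Disjoint bs → AllPairs Disjoint (alive bs)
  allPairs-alive []                                = []
  allPairs-alive {bs = (true  ∷ _) ∷ _} (_ ∷ ps)   = allPairs-alive ps
  allPairs-alive {bs = (false ∷ _) ∷ _} (ds ∷ ps)  = disjoint-alive ds ∷ allPairs-alive ps

  length-alive-disjoint : ∀ {n} {b : Vec Bool n} {bs} →
                          All (Disjoint (true ∷ b)) bs → length (alive bs) ≡ length bs
  length-alive-disjoint []                                    = refl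
  length-alive-disjoint {bs = (false ∷ _) ∷ _} (_ ∷ ds)        = cong suc (length-alive-disjoint ds)
  length-alive-disjoint {bs = (true ∷ _) ∷ _} ((() ∷ _) ∷ ds)

  -- Among pairwise disjoint inputs only one can have a 1 in first place; after it has been met,
  -- `length-alive-disjoint` shows that no other is lost.
  length-alive : ∀ {n} {bs : List (Vec Bool (suc n))} →
                 AllPairs Disjoint bs → length bs ≤ suc (length (alive bs))
  length-alive []                               = z≤n
  length-alive {bs = (true  ∷ _) ∷ _} (ds ∷ _)  = s≤s (≤-reflexive (sym (length-alive-disjoint ds)))
  length-alive {bs = (false ∷ _) ∷ _} (_ ∷ ps)  = s≤s (length-alive ps)

  disjoint-tails : ∀ {n x} {b : Vec Bool n} {bs} →
                   All (Disjoint (x ∷ b)) bs → All (Disjoint b) (map tail bs)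
  disjoint-tails []                                = []
  disjoint-tails {bs = (_ ∷ _) ∷ _} ((_ ∷ d) ∷ ds) = d ∷ disjoint-tails ds

  allPairs-tails : ∀ {n} {bs : List (Vec Bool (suc n))} →
                   AllPairs Disjoint bs → AllPairs Disjoint (map tail bs)
  allPairs-tails []                            = []
  allPairs-tails {bs = (_ ∷ _) ∷ _} (ds ∷ ps)  = disjoint-tails ds ∷ allPairs-tails ps

  -- The inputs differ only in their first `d` bits and share the ending `v`; the lower bound counts
  -- queries among the first `d` bits.
  totalQueries : ∀ {d f} → Algorithm (d + f) → Vec Bool f → List (Vec Bool d) → ℕ
  totalQueries A v bs = total (λ b → queries A (b ++ v)) bs

  totalQueries-skip : ∀ {d f} (A : Algorithm (d + f)) v bs →
                      totalQueries {suc d} (skip A) v bs ≡ totalQueries A v (map tail bs)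
  totalQueries-skip A v []             = refl
  totalQueries-skip A v ((_ ∷ b) ∷ bs) = cong (queries A (b ++ v) +_) (totalQueries-skip A v bs)

  totalQueries-query : ∀ {d f} (A : Algorithm (d + f)) v bs →
                       totalQueries {suc d} (query A) v bs ≡ length bs + totalQueries A v (alive bs)
  totalQueries-query A v []                 = refl
  totalQueries-query A v ((true  ∷ b) ∷ bs) = cong suc (totalQueries-query A v bs)
  totalQueries-query A v ((false ∷ b) ∷ bs) = cong suc (begin
    q + totalQueries (query A) v bs          ≡⟨ cong (q +_) (totalQueries-query A v bs) ⟩
    q + (length bs + totalQueries A v bs′)   ≡⟨ x∙yz≈y∙xz q (length bs) _ ⟩
    length bs + (q + totalQueries A v bs′)   ∎)
    where
    open ≡-Reasoning
    q   = queries A (b ++ v)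
    bs′ = alive bs

  -- Each query is paid for by all surviving inputs and, the inputs being
  -- disjoint, eliminates at most one of them.
  totalQueries-lower :
    ∀ {d f} (A : Algorithm (d + f)) (v : Vec Bool f) {bs} r → AllPairs Disjoint bs →
    r + ones (avoid A) ≤ d → r * length bs ≤ totalQueries A v bs + r * r
  -- `r` is a number of reads guaranteed among the next `d` bits while all answers are 0. A skip
  -- lowers `d` and `ones (avoid A)` by one, a query lowers `d` and `r` by one.
  totalQueries-lower A v zero ps le = z≤n
  totalQueries-lower {suc d} (skip A) v {bs} (suc r) ps le = begin
    suc r * length bs                                 ≡⟨ cong (suc r *_) (length-map tail bs) ⟨
    suc r * length (map tail bs)                      ≤⟨ totalQueries-lower A v (suc r) (allPairs-tails ps) le′ ⟩
    totalQueries A v (map tail bs) + suc r * suc r    ≡⟨ cong (_+ suc r * suc r) (totalQueries-skip A v bs) ⟨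
    totalQueries (skip A) v bs + suc r * suc r        ∎
    where
    open ≤-Reasoning
    le′ : suc r + ones (avoid A) ≤ d
    le′ = subst (_≤ d) (+-suc r (ones (avoid A))) (s≤s⁻¹ le)
  totalQueries-lower {suc d} (query A) v {bs} (suc r) ps le = begin
    suc r * a                             ≡⟨⟩
    a + r * a                             ≤⟨ +-monoʳ-≤ a (*-monoʳ-≤ r (length-alive ps)) ⟩
    a + r * suc a′                        ≡⟨ cong (a +_) (*-suc r a′) ⟩
    a + (r + r * a′)                      ≤⟨ +-monoʳ-≤ a (+-monoʳ-≤ r (totalQueries-lower A v r (allPairs-alive ps) (s≤s⁻¹ le))) ⟩
    -- The exact loss for `r` reads would be 0 + 1 + ... + (r - 1). The square is a simpler bound:
    -- passing from `r * r` to `suc r * suc r` gives the `r` required here and a spare `suc r`.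
    a + (r + (S + r * r))                 ≤⟨ m≤m+n _ (suc r) ⟩
    a + (r + (S + r * r)) + suc r         ≡⟨ lemma a r S ⟩
    a + S + suc r * suc r                 ≡⟨ cong (_+ suc r * suc r) (totalQueries-query A v bs) ⟨
    totalQueries (query A) v bs + suc r * suc r ∎
    where
    open ≤-Reasoning
    a  = length bs
    a′ = length (alive bs)
    S  = totalQueries A v (alive bs)
    lemma : ∀ a r S → a + (r + (S + r * r)) + suc r ≡ a + S + suc r * suc r
    lemma = solve-∀

  -- Inputs with a single block of ones

  width : ℕ → ℕ → ℕ → ℕ
  width m e zero    = e
  width m e (suc k) = m + width m e k

  width-≡ : ∀ m e k → width m e k ≡ k * m + e
  width-≡ m e zero    = refl
  width-≡ m e (suc k) = trans (cong (m +_) (width-≡ m e k)) (sym (+-assoc m (k * m) e))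

  -- There are `k` places of length `m`, followed by `e` padding zeros. Since `width` recurses like
  -- this list, the lengths agree by computation.
  blocks : ∀ m e k → List (Vec Bool (width m e k))
  blocks m e zero    = []
  blocks m e (suc k) = (replicate m true ++ replicate (width m e k) false)
                     ∷ map (replicate m false ++_) (blocks m e k)

  length-blocks : ∀ m e k → length (blocks m e k) ≡ k
  length-blocks m e zero    = refl
  length-blocks m e (suc k) = cong suc (trans (length-map _ (blocks m e k)) (length-blocks m e k))

  disjoint-false : ∀ {n} (b : Vec Bool n) → Disjoint (replicate n false) b
  disjoint-false []      = []
  disjoint-false (_ ∷ b) = refl ∷ disjoint-false b

  true-disjoint-false : ∀ m → Disjoint (replicate m true) (replicate m false)
  true-disjoint-false zero    = []
  true-disjoint-false (suc m) = refl ∷ true-disjoint-false m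

  disjoint-blocks : ∀ m e k → AllPairs Disjoint (blocks m e k)
  disjoint-blocks m e zero    = []
  disjoint-blocks m e (suc k) =
    All.map⁺ (All.universal (λ b → Pointwise.++⁺ (true-disjoint-false m) (disjoint-false b)) (blocks m e k))
    ∷ AllPairs.map⁺ (AllPairs.map (Pointwise.++⁺ (disjoint-false (replicate m false))) (disjoint-blocks m e k))

  ones-++ : ∀ {m n} (b : Vec Bool m) (c : Vec Bool n) → ones (b ++ c) ≡ ones b + ones c
  ones-++ []          c = refl
  ones-++ (true  ∷ b) c = cong suc (ones-++ b c)
  ones-++ (false ∷ b) c = ones-++ b c

  ones-true : ∀ n → ones (replicate n true) ≡ n
  ones-true zero    = refl
  ones-true (suc n) = cong suc (ones-true n)

  ones-false : ∀ n → ones (replicate n false) ≡ 0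
  ones-false zero    = refl
  ones-false (suc n) = ones-false n

  ones-blocks : ∀ m e k → All (λ b → ones b ≡ m) (blocks m e k)
  ones-blocks m e zero    = []
  ones-blocks m e (suc k) =
    trans (ones-++ (replicate m true) (replicate (width m e k) false))
          (trans (cong₂ _+_ (ones-true m) (ones-false (width m e k))) (+-identityʳ m))
    ∷ All.map⁺ (All.map (λ {b} eq → trans (ones-++ (replicate m false) b)
                                          (trans (cong (_+ ones b) (ones-false m)) eq))
                        (ones-blocks m e k))

  -- The whole combinatorial lower bound, stated for a single deterministic algorithm: either it
  -- averages at least m / 2 queries over the `2 * m` inputs, or it fails on some valid input.
  hardInputs : ∀ n m → 2 * m * (2 * m) ≤ n → ∃[ bs ]
    (length bs ≡ 2 * m × All (Valid {n}) bs ×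
     (∀ A → m * m ≤ total (queries A) bs ⊎ ∃[ b ] (Valid b × finds A b ≡ false)))
  hardInputs n m 4m²≤n = subst (λ N → ∃[ bs ]
    (length bs ≡ 2 * m × All (Valid {N}) bs ×
     (∀ A → m * m ≤ total (queries A) bs ⊎ ∃[ b ] (Valid b × finds A b ≡ false))))
    (sym n≡)
    (inputs , trans (length-map _ (blocks m e (2 * m))) (length-blocks m e (2 * m)) , valid , bound)
    where
    h = proj₁ (halve n)
    2h≤n = proj₁ (proj₂ (halve n))
    n≤1+2h = proj₂ (proj₂ (halve n))
    -- This makes the `2 * m` blocks fit. From 4m² ≤ n ≤ 1 + 2h follows 2 (2m²) < 2 (1 + h), and
    -- halving the strict inequality absorbs the odd bit.
    2m²≤h : 2 * m * m ≤ h
    2m²≤h = s≤s⁻¹ (*-cancelˡ-< 2 _ _ (≤-<-trans (≤-trans (≤-reflexive (lemma m)) 4m²≤n)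
              (≤-<-trans n≤1+2h (≤-reflexive (lemma₂ h)))))
      where
      lemma : ∀ m → 2 * (2 * m * m) ≡ 2 * m * (2 * m)
      lemma = solve-∀
      lemma₂ : ∀ h → 2 + 2 * h ≡ 2 * (1 + h)
      lemma₂ = solve-∀
    m≤2m² : ∀ m → m ≤ 2 * m * m
    m≤2m² zero      = z≤n
    m≤2m² m@(suc _) = m≤n*m m (2 * m)
    h+m≤n : h + m ≤ n
    h+m≤n = ≤-trans (+-monoʳ-≤ h (≤-trans (≤-trans (m≤2m² m) 2m²≤h) (m≤m+n h 0))) 2h≤n
    e = h + m ∸ 2 * m * m
    f = n ∸ (h + m)
    d = width m e (2 * m)
    d≡ : d ≡ h + m
    d≡ = trans (width-≡ m e (2 * m)) (m+[n∸m]≡n (≤-trans 2m²≤h (m≤m+n h m)))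
    n≡ : n ≡ d + f
    n≡ = sym (trans (cong (_+ f) d≡) (m+[n∸m]≡n h+m≤n))
    ends = replicate f true
    inputs = map (_++ ends) (blocks m e (2 * m))

    bound : ∀ (A : Algorithm (d + f)) → m * m ≤ total (queries A) inputs ⊎ ∃[ b ] (Valid b × finds A b ≡ false)
    bound A with d + f ≤? 2 * ones (avoid A)
    ... | yes v = inj₂ (avoid A , v , finds-avoid A)
    ... | no ¬v = inj₁ (+-cancelʳ-≤ (m * m) _ _ (begin
      m * m + m * m                                     ≡⟨ lemma m ⟩
      m * (2 * m)                                       ≡⟨ cong (m *_) (length-blocks m e (2 * m)) ⟨
      m * length (blocks m e (2 * m))                   ≤⟨ totalQueries-lower A ends m (disjoint-blocks m e (2 * m)) room ⟩
      totalQueries A ends (blocks m e (2 * m)) + m * m  ≡⟨ cong (_+ m * m) (total-map (queries A) (_++ ends) (blocks m e (2 * m))) ⟨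
      total (queries A) inputs + m * m                  ∎))
      where
      open ≤-Reasoning
      lemma : ∀ m → m * m + m * m ≡ m * (2 * m)
      lemma = solve-∀
      -- As `avoid A` is not valid, twice its number of ones is below n ≤ 1 + 2h, so `A` skips at
      -- most `h` bits; the prefix has length h + m.
      room : m + ones (avoid A) ≤ d
      room = subst (m + ones (avoid A) ≤_) (trans (+-comm m h) (sym d≡)) (+-monoʳ-≤ m
        (*-cancelˡ-≤ 2 (s≤s⁻¹ (≤-trans (≰⇒> ¬v) (subst (_≤ suc (2 * h)) n≡ n≤1+2h)))))

    valid : All Valid inputs
    valid = All.map⁺ (All.map (λ {b} ones≡m → subst (_≤ 2 * ones (b ++ ends)) n≡
      (begin
        n                         ≤⟨ half-bound ⟩
        2 * (m + f)               ≡⟨ cong (2 *_) (cong₂ _+_ ones≡m (ones-true f)) ⟨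
        2 * (ones b + ones ends)  ≡⟨ cong (2 *_) (ones-++ b ends) ⟨
        2 * ones (b ++ ends)      ∎))
      (ones-blocks m e (2 * m)))
      where
      open ≤-Reasoning
      -- Each input has m + f = n - h ones, and 2h ≤ n.
      half-bound : n ≤ 2 * (m + f)
      half-bound = +-cancelˡ-≤ (2 * h) _ _ (begin
        2 * h + n                ≤⟨ +-monoˡ-≤ n 2h≤n ⟩
        n + n                    ≡⟨ cong (λ x → x + x) (m+[n∸m]≡n h+m≤n) ⟨
        h + m + f + (h + m + f)  ≡⟨ lemma h m f ⟩
        2 * h + 2 * (m + f)      ∎)
        where
        lemma : ∀ h m f → h + m + f + (h + m + f) ≡ 2 * h + 2 * (m + f)
        lemma = solve-∀

  -- The sampling algorithm

  queryAll : ∀ n → Algorithm n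
  queryAll zero    = end
  queryAll (suc n) = query (queryAll n)

  -- Choosing uniformly from this list queries each of the first h bits
  -- independently with probability 1 / (1 + t), then all of the last l bits.
  sampling : ∀ t h l → List (Algorithm (h + l))
  sampling t zero    l = queryAll l ∷ []
  sampling t (suc h) l =
    map query (sampling t h l) List.++ concat (List.replicate t (map skip (sampling t h l)))

  total-sampling : ∀ t h l (f : Algorithm (suc h + l) → ℕ) →
    total f (sampling t (suc h) l) ≡
    total (f ∘ query) (sampling t h l) + t * total (f ∘ skip) (sampling t h l)
  total-sampling t h l f = begin
    total f (map query L List.++ concat (List.replicate t (map skip L)))  ≡⟨ total-++ f (map query L) _ ⟩
    total f (map query L) + total f (concat (List.replicate t (map skip L)))
      ≡⟨ cong₂ _+_ (total-map f query L) (trans (total-replicate f t (map skip L)) (cong (t *_) (total-map f skip L))) ⟩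
    total (f ∘ query) L + t * total (f ∘ skip) L ∎
    where
    open ≡-Reasoning
    L = sampling t h l

  length-sampling : ∀ t h l → length (sampling t h l) ≡ suc t ^ h
  length-sampling t zero    l = refl
  length-sampling t (suc h) l = begin
    length (sampling t (suc h) l)                ≡⟨ total-1 (sampling t (suc h) l) ⟨
    total (λ _ → 1) (sampling t (suc h) l)       ≡⟨ total-sampling t h l (λ _ → 1) ⟩
    total (λ _ → 1) L + t * total (λ _ → 1) L    ≡⟨ cong (suc t *_) (trans (total-1 L) (length-sampling t h l)) ⟩
    suc t * suc t ^ h                            ∎
    where
    open ≡-Reasoning
    L = sampling t h l

  -- Every query except possibly the last returns 0, so there is at most one query more than there
  -- are zeros.
  queries-queryAll : ∀ {l} (b : Vec Bool l) → queries (queryAll l) b + ones b ≤ suc l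
  queries-queryAll []          = z≤n
  queries-queryAll {suc l} (true  ∷ b) = s≤s (s≤s (count≤n (_≟ true) b))
  queries-queryAll (false ∷ b) = s≤s (queries-queryAll b)

  finds-queryAll : ∀ {l} (b : Vec Bool l) → 0 < ones b → finds (queryAll l) b ≡ true
  finds-queryAll (true  ∷ b) _ = refl
  finds-queryAll (false ∷ b) p = finds-queryAll b p

  -- The first `h` bits cannot hold more than `h` ones, so a 1 remains among the last `l` bits, all
  -- of which are queried if necessary.
  sampling-finds : ∀ t h l (b : Vec Bool (h + l)) → h < ones b →
                   All (λ A → finds A b ≡ true) (sampling t h l)
  sampling-finds t zero    l b           p = finds-queryAll b p ∷ []
  sampling-finds t (suc h) l (x ∷ b)     p =
    All.++⁺ (All.map⁺ (queried x p)) (All.concat⁺ (All.replicate⁺ t (All.map⁺ (rec x p))))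
    where
    rec : ∀ x → suc h < ones (x ∷ b) → All (λ A → finds A b ≡ true) (sampling t h l)
    rec true  p = sampling-finds t h l b (s≤s⁻¹ p)
    rec false p = sampling-finds t h l b (<-trans (n<1+n h) p)
    queried : ∀ x → suc h < ones (x ∷ b) → All (λ A → finds (query A) (x ∷ b) ≡ true) (sampling t h l)
    queried true  p = All.universal (λ _ → refl) (sampling t h l)
    queried false p = rec false p

  -- With s = 1 + t this bounds the mean number of queries by
  -- h / s + s + (1 + l − c), where c counts ones that are known to exist: a one
  -- within the first h bits lowers the mean by a factor 1 − 1 / s, which costs
  -- at least one query as long as the bound is at least s.
  sampling-queries : ∀ t h l (b : Vec Bool (h + l)) c → c ≤ ones b → c ≤ suc l →
    suc t * total (λ A → queries A b) (sampling t h l) + suc t * c * suc t ^ h ≤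
    suc t ^ h * (h + suc t * suc t + suc t * suc l)
  sampling-queries t zero l b c c≤ones c≤1+l = begin
    suc t * (q + 0) + suc t * c * 1    ≡⟨ lemma (suc t) q c ⟩
    suc t * (q + c)                    ≤⟨ *-monoʳ-≤ (suc t) (≤-trans (+-monoʳ-≤ q c≤ones) (queries-queryAll b)) ⟩
    suc t * suc l                      ≤⟨ m≤n+m (suc t * suc l) (suc t * suc t) ⟩
    suc t * suc t + suc t * suc l      ≡⟨ *-identityˡ _ ⟨
    1 * (suc t * suc t + suc t * suc l) ∎
    where
    open ≤-Reasoning
    q = queries (queryAll l) b
    lemma : ∀ s q c → s * (q + 0) + s * c * 1 ≡ s * (q + c)
    lemma = solve-∀
  sampling-queries t (suc h) l (false ∷ b) c c≤ones c≤1+l = begin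
    s * total (λ A → queries A (false ∷ b)) (sampling t (suc h) l) + s * c * (s * N)
      ≡⟨ cong (λ x → s * x + s * c * (s * N)) (total-sampling t h l _) ⟩
    s * (total (suc ∘ q) L + t * T) + s * c * (s * N)
      ≡⟨ cong (λ x → s * (x + t * T) + s * c * (s * N)) (trans (total-suc q L) (cong (_+ T) (length-sampling t h l))) ⟩
    s * (N + T + t * T) + s * c * (s * N)
      ≡⟨ lemma t N T c ⟩
    s * N + s * (s * T + s * c * N)
      ≤⟨ +-monoʳ-≤ (s * N) (*-monoʳ-≤ s (sampling-queries t h l b c c≤ones c≤1+l)) ⟩
    s * N + s * (N * (h + s * s + s * suc l))
      ≡⟨ lemma₂ s N h (suc l) ⟩
    s * N * (suc h + s * s + s * suc l) ∎
    where
    open ≤-Reasoning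
    s = suc t
    N = s ^ h
    L = sampling t h l
    q = λ A → queries A b
    T = total q L
    lemma : ∀ t N T c → suc t * (N + T + t * T) + suc t * c * (suc t * N) ≡
                        suc t * N + suc t * (suc t * T + suc t * c * N)
    lemma = solve-∀
    lemma₂ : ∀ s N h l → s * N + s * (N * (h + s * s + s * l)) ≡ s * N * (suc h + s * s + s * l)
    lemma₂ = solve-∀
  sampling-queries t (suc h) l (true ∷ b) c c≤ones c≤1+l = goal c c≤ones c≤1+l
    where
    open ≤-Reasoning
    s = suc t
    N = s ^ h
    L = sampling t h l
    q = λ A → queries A b
    T = total q L
    T≡ : total (λ A → queries A (true ∷ b)) (sampling t (suc h) l) ≡ N + t * T
    T≡ = trans (total-sampling t h l _) (cong (_+ t * T) (trans (total-1 L) (length-sampling t h l)))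

    bound : ∀ c e → c + e ≡ suc l → c ≤ ones b →
            s * (N + t * T) + s * suc c * (s * N) ≤ s * N * (suc h + s * s + s * suc l)
    bound c e eq p = +-cancelʳ-≤ (t * (s * c * N)) _ _ (begin
      s * (N + t * T) + s * suc c * (s * N) + t * (s * c * N)
        ≡⟨ lemma t N T c ⟩
      t * (s * T + s * c * N) + s * N + s * suc c * (s * N)
        ≤⟨ +-monoˡ-≤ _ (+-monoˡ-≤ (s * N) (*-monoʳ-≤ t (sampling-queries t h l b c p (m+n≤o⇒m≤o c (≤-reflexive eq))))) ⟩
      t * (N * (h + s * s + s * suc l)) + s * N + s * suc c * (s * N)
        ≡⟨ cong (λ x → t * (N * (h + s * s + s * x)) + s * N + s * suc c * (s * N)) eq ⟨
      t * (N * (h + s * s + s * (c + e))) + s * N + s * suc c * (s * N)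
        -- Let B = h / s + s + e be the bound for `b`. Stopping with probability 1 / s saves B / s:
        -- the summand s of B saves the one query by which the new bound is smaller, and the savings
        -- from h / s and e are given away here.
        ≤⟨ m≤m+n _ (N * h + s * e * N) ⟩
      t * (N * (h + s * s + s * (c + e))) + s * N + s * suc c * (s * N) + (N * h + s * e * N)
        ≡⟨ lemma₂ t N h c e ⟩
      s * N * (suc h + s * s + s * (c + e)) + t * (s * c * N)
        ≡⟨ cong (λ x → s * N * (suc h + s * s + s * x) + t * (s * c * N)) eq ⟩
      s * N * (suc h + s * s + s * suc l) + t * (s * c * N) ∎)
      where
      lemma : ∀ t N T c → suc t * (N + t * T) + suc t * suc c * (suc t * N) + t * (suc t * c * N) ≡
                          t * (suc t * T + suc t * c * N) + suc t * N + suc t * suc c * (suc t * N)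
      lemma = solve-∀
      lemma₂ : ∀ t N h c e →
        t * (N * (h + suc t * suc t + suc t * (c + e))) + suc t * N + suc t * suc c * (suc t * N) + (N * h + suc t * e * N) ≡
        suc t * N * (suc h + suc t * suc t + suc t * (c + e)) + t * (suc t * c * N)
      lemma₂ = solve-∀

    goal : ∀ c → c ≤ ones (true ∷ b) → c ≤ suc l →
      s * total (λ A → queries A (true ∷ b)) (sampling t (suc h) l) + s * c * (s * N) ≤
      s * N * (suc h + s * s + s * suc l)
    goal zero    _ _ = begin
      s * total (λ A → queries A (true ∷ b)) (sampling t (suc h) l) + s * 0 * (s * N)
        ≡⟨ cong (λ x → s * x + s * 0 * (s * N)) T≡ ⟩
      s * (N + t * T) + s * 0 * (s * N)
        -- The first bit is itself a 1, so the stronger bound with one known 1 is available.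
        ≤⟨ +-monoʳ-≤ (s * (N + t * T)) (*-monoˡ-≤ (s * N) (*-monoʳ-≤ s (z≤n {1}))) ⟩
      s * (N + t * T) + s * 1 * (s * N)
        ≤⟨ bound 0 (suc l) refl z≤n ⟩
      s * N * (suc h + s * s + s * suc l) ∎
    goal (suc c) (s≤s p) (s≤s r) = begin
      s * total (λ A → queries A (true ∷ b)) (sampling t (suc h) l) + s * suc c * (s * N)
        ≡⟨ cong (λ x → s * x + s * suc c * (s * N)) T≡ ⟩
      s * (N + t * T) + s * suc c * (s * N)
        ≤⟨ bound c (suc l ∸ c) (m+[n∸m]≡n (m≤n⇒m≤1+n r)) p ⟩
      s * N * (suc h + s * s + s * suc l) ∎

  valid⇒ones : ∀ {h n} → 2 * h < n → (b : Vec Bool n) → Valid b → h < ones b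
  valid⇒ones 2h<n b v = *-cancelˡ-< 2 _ _ (<-≤-trans 2h<n v)

  -- A valid input has at least 1 + h ones, so `sampling-queries` applies with c = 1 + h. With s = 1
  -- + t the mean is at most h / s + s + (l - h), hence at most (2 + s) + s + 2, which is at most 6s
  -- as s ≥ 1.
  sampling-total : ∀ t h l → 2 * h < h + l → l ≤ 2 + h → h ≤ suc t * (2 + suc t) →
    ∀ b → Valid b → total (λ A → queries A b) (sampling t h l) ≤ length (sampling t h l) * (6 * suc t)
  sampling-total t h l 2h<n l≤2+h h≤ b v = subst (λ x → T ≤ x * (6 * s)) (sym (length-sampling t h l))
      (*-cancelˡ-≤ s (+-cancelʳ-≤ (s * suc h * N) _ _ (begin
        s * T + s * suc h * N
          ≤⟨ sampling-queries t h l b (suc h) (valid⇒ones 2h<n b v) (m≤n⇒m≤1+n h<l) ⟩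
        N * (h + s * s + s * suc l)
          ≤⟨ *-monoʳ-≤ N (+-mono-≤ (+-monoˡ-≤ (s * s) h≤) (*-monoʳ-≤ s (s≤s l≤2+h))) ⟩
        N * (s * (2 + s) + s * s + s * (3 + h))
          ≤⟨ m≤m+n _ (4 * N * s * t) ⟩
        N * (s * (2 + s) + s * s + s * (3 + h)) + 4 * N * s * t
          ≡⟨ lemma t N h ⟩
        s * (N * (6 * s)) + s * suc h * N ∎)))
      where
      open ≤-Reasoning
      s = suc t
      N = s ^ h
      L = sampling t h l
      h<l : h < l
      h<l = +-cancelˡ-< h _ _ (subst (_< h + l) (cong (h +_) (+-identityʳ h)) 2h<n)
      T = total (λ A → queries A b) L
      lemma : ∀ t N h →
        N * (suc t * (2 + suc t) + suc t * suc t + suc t * (3 + h)) + 4 * N * suc t * t ≡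
        suc t * (N * (6 * suc t)) + suc t * suc h * N
      lemma = solve-∀

open Deterministic

-- Rational and real numbers

open import Data.Rational as ℚ
  using (ℚ; 0ℚ; 1ℚ; ½; _+_; _*_; -_; _-_; _/_; _≤_; _<_; 1/_; Positive; NonNegative; nonNegative; toℚᵘ)
open import Data.Rational.Properties
import Data.Rational.Unnormalised as ℚᵘ
import Data.Rational.Unnormalised.Properties as ℚᵘ

module ℚ-Sum = Sum +-0-commutativeMonoid
module ℚ-Mult = Mult +-0-commutativeMonoid
module ℚ-Semigroup = CommutativeSemigroup (CommutativeMonoid.commutativeSemigroup +-0-commutativeMonoid)
open ℝ-Sum using () renaming (sum to ∑ᵣ; _×_ to _×ᵣ_)

-- Natural numbers as rationals

ι : ℕ → ℚ
ι n = ℤ.+ n / 1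

private
  ιᵘ : ℕ → ℚᵘ.ℚᵘ
  ιᵘ n = ℚᵘ.mkℚᵘ (ℤ.+ n) 0

  toℚᵘ-ι : ∀ n → toℚᵘ (ι n) ℚᵘ.≃ ιᵘ n
  toℚᵘ-ι n = toℚᵘ-fromℚᵘ (ιᵘ n)

ι-+ : ∀ m n → ι (m ℕ.+ n) ≡ ι m + ι n
ι-+ m n = toℚᵘ-injective (ℚᵘ.≃-trans (toℚᵘ-ι (m ℕ.+ n)) (ℚᵘ.≃-sym (ℚᵘ.≃-trans (toℚᵘ-homo-+ (ι m) (ι n))
  (ℚᵘ.≃-trans (ℚᵘ.+-cong (toℚᵘ-ι m) (toℚᵘ-ι n))
    (ℚᵘ.*≡* (cong (ℤ._* ℤ.1ℤ) (cong₂ ℤ._+_ (ℤ.*-identityʳ (ℤ.+ m)) (ℤ.*-identityʳ (ℤ.+ n)))))))))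

ι-* : ∀ m n → ι (m ℕ.* n) ≡ ι m * ι n
ι-* m n = toℚᵘ-injective (ℚᵘ.≃-trans (toℚᵘ-ι (m ℕ.* n)) (ℚᵘ.≃-sym (ℚᵘ.≃-trans (toℚᵘ-homo-* (ι m) (ι n))
  (ℚᵘ.≃-trans (ℚᵘ.*-cong (toℚᵘ-ι m) (toℚᵘ-ι n))
    (ℚᵘ.*≡* (cong (ℤ._* ℤ.1ℤ) (sym (ℤ.pos-* m n))))))))

ι-mono-≤ : ∀ {m n} → m ℕ.≤ n → ι m ≤ ι n
ι-mono-≤ {m} {n} m≤n = toℚᵘ-cancel-≤ (ℚᵘ.≤-respˡ-≃ (ℚᵘ.≃-sym (toℚᵘ-ι m)) (ℚᵘ.≤-respʳ-≃ (ℚᵘ.≃-sym (toℚᵘ-ι n))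
  (ℚᵘ.*≤* (ℤ.*-monoʳ-≤-nonNeg ℤ.1ℤ (ℤ.+≤+ m≤n)))))

ι-mono-< : ∀ {m n} → m ℕ.< n → ι m < ι n
ι-mono-< {m} {n} m<n = toℚᵘ-cancel-< (ℚᵘ.<-respˡ-≃ (ℚᵘ.≃-sym (toℚᵘ-ι m)) (ℚᵘ.<-respʳ-≃ (ℚᵘ.≃-sym (toℚᵘ-ι n))
  (ℚᵘ.*<* (ℤ.*-monoʳ-<-pos ℤ.1ℤ (ℤ.+<+ m<n)))))

ι-nonNegative : ∀ n → NonNegative (ι n)
ι-nonNegative n = normalize-nonNeg n 1

ι-positive : ∀ n .{{_ : ℕ.NonZero n}} → Positive (ι n)
ι-positive n = normalize-pos n 1

×≡ι* : ∀ n p → n ℚ-Mult.× p ≡ ι n * p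
×≡ι* zero    p = sym (*-zeroˡ p)
×≡ι* (suc n) p = begin
  p + n ℚ-Mult.× p   ≡⟨ cong₂ _+_ (sym (*-identityˡ p)) (×≡ι* n p) ⟩
  1ℚ * p + ι n * p   ≡⟨ *-distribʳ-+ p 1ℚ (ι n) ⟨
  (1ℚ + ι n) * p     ≡⟨ cong (_* p) (ι-+ 1 n) ⟨
  ι (suc n) * p      ∎
  where open ≡-Reasoning

-- Order and finite sums of Cauchy reals

Eventually-map : ∀ {P R : ℕ → Set} → (∀ {k} → P k → R k) → Eventually P → Eventually R
Eventually-map f (N , p) = N , λ k N≤k → f (p k N≤k)

Eventually-map₂ : ∀ {P R S : ℕ → Set} → (∀ {k} → P k → R k → S k) →
                  Eventually P → Eventually R → Eventually S
Eventually-map₂ f (M , p) (N , r) = M ℕ.⊔ N , λ k le →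
  f (p k (ℕ.m⊔n≤o⇒m≤o M N le)) (r k (ℕ.m⊔n≤o⇒n≤o M N le))

infix 4 _≐_

-- Termwise equality of the representing sequences is finer than `_≈ᵣ_`. The algebraic identities
-- for means hold in this form and so reduce to identities of rational sums.
_≐_ : ℝ → ℝ → Set
x ≐ y = ∀ k → seq x k ≡ seq y k

p≤p+ε : ∀ p {ε} → 0ℚ < ε → p ≤ p + ε
p≤p+ε p {ε} 0<ε = subst (_≤ p + ε) (+-identityʳ p) (+-monoʳ-≤ p (<⇒≤ 0<ε))

halves : ∀ ε → ε * ½ + ε * ½ ≡ ε
halves ε = trans (sym (*-distribˡ-+ ε ½ ½)) (*-identityʳ ε)

half-positive : ∀ {ε} → 0ℚ < ε → 0ℚ < ε * ½
half-positive = *-monoˡ-<-pos ½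

≐⇒≤ᵣ : ∀ x y → x ≐ y → x ≤ᵣ y
≐⇒≤ᵣ x y x≐y ε 0<ε = 0 , λ k _ → ≤-trans (≤-reflexive (x≐y k)) (p≤p+ε (seq y k) 0<ε)

≐⇒≥ᵣ : ∀ x y → x ≐ y → y ≤ᵣ x
≐⇒≥ᵣ x y x≐y = ≐⇒≤ᵣ y x (λ k → sym (x≐y k))

≐⇒≈ᵣ : ∀ x y → x ≐ y → x ≈ᵣ y
≐⇒≈ᵣ x y x≐y = ≐⇒≤ᵣ x y x≐y , ≐⇒≥ᵣ x y x≐y

≤ᵣ-refl : ∀ x → x ≤ᵣ x
≤ᵣ-refl x = ≐⇒≤ᵣ x x (λ _ → refl)

≤ᵣ-trans : ∀ x y z → x ≤ᵣ y → y ≤ᵣ z → x ≤ᵣ z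
≤ᵣ-trans x y z x≤y y≤z ε 0<ε = Eventually-map₂
  (λ {k} p r → ≤-trans p (≤-trans (+-monoˡ-≤ (ε * ½) r)
     (≤-reflexive (trans (+-assoc (seq z k) (ε * ½) (ε * ½)) (cong (seq z k +_) (halves ε))))))
  (x≤y (ε * ½) (half-positive 0<ε)) (y≤z (ε * ½) (half-positive 0<ε))

+ᵣ-mono-≤ᵣ : ∀ x y u v → x ≤ᵣ y → u ≤ᵣ v → x +ᵣ u ≤ᵣ y +ᵣ v
+ᵣ-mono-≤ᵣ x y u v x≤y u≤v ε 0<ε = Eventually-map₂
  (λ {k} p r → ≤-trans (+-mono-≤ p r) (≤-reflexive
     (trans (ℚ-Semigroup.interchange (seq y k) (ε * ½) (seq v k) (ε * ½)) (cong (seq y k + seq v k +_) (halves ε)))))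
  (x≤y (ε * ½) (half-positive 0<ε)) (u≤v (ε * ½) (half-positive 0<ε))

+ᵣ-cancelˡ-≤ᵣ : ∀ x y z → x +ᵣ y ≤ᵣ x +ᵣ z → y ≤ᵣ z
+ᵣ-cancelˡ-≤ᵣ x y z le ε 0<ε = Eventually-map (λ {k} p →
  subst₂ _≤_ (cancel (seq x k) (seq y k))
             (trans (cong (- seq x k +_) (+-assoc (seq x k) (seq z k) ε)) (cancel (seq x k) (seq z k + ε)))
             (+-monoʳ-≤ (- seq x k) p))
  (le ε 0<ε)
  where
  cancel : ∀ a b → - a + (a + b) ≡ b
  cancel a b = trans (sym (+-assoc (- a) a b)) (trans (cong (_+ b) (+-inverseˡ a)) (+-identityˡ b))

-- If q < p, choose d strictly between them; tolerance d - q then gives p ≤ d, a contradiction.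
fromℚ-cancel-≤ᵣ : ∀ {p q} → fromℚ p ≤ᵣ fromℚ q → p ≤ q
fromℚ-cancel-≤ᵣ {p} {q} le = ≮⇒≥ λ q<p →
  let d , q<d , d<p = <-dense q<p
      N , close     = le (d - q) (subst (_< d - q) (+-inverseʳ q) (+-monoˡ-< (- q) q<d))
  in <-irrefl refl (<-≤-trans d<p (≤-trans (close N ℕ.≤-refl) (≤-reflexive
       (trans (+-comm q (d - q)) (trans (+-assoc d (- q) q)
         (trans (cong (d +_) (+-inverseˡ q)) (+-identityʳ d)))))))

seq-∑ : ∀ {N} (f : Fin N → ℝ) k → seq (∑ᵣ f) k ≡ ℚ-Sum.sum (λ i → seq (f i) k)
seq-∑ {zero}  f k = refl
seq-∑ {suc N} f k = cong (seq (f zero) k +_) (seq-∑ (f ∘ suc) k)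

seq-× : ∀ n x k → seq (n ×ᵣ x) k ≡ n ℚ-Mult.× seq x k
seq-× zero    x k = refl
seq-× (suc n) x k = cong (seq x k +_) (seq-× n x k)

×-monoʳ-≤ᵣ : ∀ n x y → x ≤ᵣ y → n ×ᵣ x ≤ᵣ n ×ᵣ y
×-monoʳ-≤ᵣ zero    x y x≤y = ≤ᵣ-refl 0ᵣ
×-monoʳ-≤ᵣ (suc n) x y x≤y = +ᵣ-mono-≤ᵣ x y (n ×ᵣ x) (n ×ᵣ y) x≤y (×-monoʳ-≤ᵣ n x y x≤y)

×-zeroʳ : ∀ n → n ×ᵣ 0ᵣ ≐ 0ᵣ
×-zeroʳ n k = trans (seq-× n 0ᵣ k) (trans (×≡ι* n 0ℚ) (*-zeroʳ (ι n)))

×-monoˡ-≤ᵣ : ∀ {m n} x → 0ᵣ ≤ᵣ x → m ℕ.≤ n → m ×ᵣ x ≤ᵣ n ×ᵣ x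
×-monoˡ-≤ᵣ {n = n} x 0≤x z≤n = ≤ᵣ-trans 0ᵣ (n ×ᵣ 0ᵣ) (n ×ᵣ x)
  (≐⇒≥ᵣ (n ×ᵣ 0ᵣ) 0ᵣ (×-zeroʳ n)) (×-monoʳ-≤ᵣ n 0ᵣ x 0≤x)
×-monoˡ-≤ᵣ x 0≤x (s≤s {m} {n} m≤n) =
  +ᵣ-mono-≤ᵣ x x (m ×ᵣ x) (n ×ᵣ x) (≤ᵣ-refl x) (×-monoˡ-≤ᵣ x 0≤x m≤n)

∑-mono-≤ᵣ : ∀ {N} (f g : Fin N → ℝ) → (∀ i → f i ≤ᵣ g i) → ∑ᵣ f ≤ᵣ ∑ᵣ g
∑-mono-≤ᵣ {zero}  f g le = ≤ᵣ-refl 0ᵣ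
∑-mono-≤ᵣ {suc N} f g le =
  +ᵣ-mono-≤ᵣ (f zero) (g zero) (∑ᵣ (f ∘ suc)) (∑ᵣ (g ∘ suc)) (le zero)
    (∑-mono-≤ᵣ (f ∘ suc) (g ∘ suc) (le ∘ suc))

∑-nonneg : ∀ {N} (f : Fin N → ℝ) → (∀ i → 0ᵣ ≤ᵣ f i) → 0ᵣ ≤ᵣ ∑ᵣ f
∑-nonneg {zero}  f 0≤f = ≤ᵣ-refl 0ᵣ
∑-nonneg {suc N} f 0≤f =
  +ᵣ-mono-≤ᵣ 0ᵣ (f zero) 0ᵣ (∑ᵣ (f ∘ suc)) (0≤f zero) (∑-nonneg (f ∘ suc) (0≤f ∘ suc))

term≤∑ : ∀ {N} (f : Fin N → ℝ) → (∀ i → 0ᵣ ≤ᵣ f i) → ∀ i → f i ≤ᵣ ∑ᵣ f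
term≤∑ f 0≤f zero = ≤ᵣ-trans (f zero) (f zero +ᵣ 0ᵣ) (∑ᵣ f)
  (≐⇒≤ᵣ (f zero) (f zero +ᵣ 0ᵣ) (λ k → sym (+-identityʳ (seq (f zero) k))))
  (+ᵣ-mono-≤ᵣ (f zero) (f zero) 0ᵣ (∑ᵣ (f ∘ suc)) (≤ᵣ-refl (f zero)) (∑-nonneg (f ∘ suc) (0≤f ∘ suc)))
term≤∑ f 0≤f (suc i) = ≤ᵣ-trans (f (suc i)) (0ᵣ +ᵣ f (suc i)) (∑ᵣ f)
  (≐⇒≤ᵣ (f (suc i)) (0ᵣ +ᵣ f (suc i)) (λ k → sym (+-identityˡ (seq (f (suc i)) k))))
  (+ᵣ-mono-≤ᵣ 0ᵣ (f zero) (f (suc i)) (∑ᵣ (f ∘ suc)) (0≤f zero) (term≤∑ (f ∘ suc) (0≤f ∘ suc) i))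

-- Expectations on a finite weighted space

mean : ∀ {N} → (Fin N → ℝ) → (Fin N → ℕ) → ℝ
mean w X = ∑ᵣ λ ω → X ω ×ᵣ w ω

module _ {N} (w : Fin N → ℝ) where

  seq-mean : ∀ X k → seq (mean w X) k ≡ ℚ-Sum.sum (λ ω → X ω ℚ-Mult.× seq (w ω) k)
  seq-mean X k = trans (seq-∑ (λ ω → X ω ×ᵣ w ω) k)
                       (ℚ-Sum.sum-cong-≗ (λ ω → seq-× (X ω) (w ω) k))

  mean-+ : ∀ X Y k → seq (mean w (λ ω → X ω ℕ.+ Y ω)) k ≡ seq (mean w X) k + seq (mean w Y) k
  mean-+ X Y k = begin
    seq (mean w (λ ω → X ω ℕ.+ Y ω)) k                     ≡⟨ seq-mean (λ ω → X ω ℕ.+ Y ω) k ⟩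
    ℚ-Sum.sum (λ ω → (X ω ℕ.+ Y ω) ℚ-Mult.× v ω)           ≡⟨ ℚ-Sum.sum-cong-≗ (λ ω → ℚ-Mult.×-homo-+ (v ω) (X ω) (Y ω)) ⟩
    ℚ-Sum.sum (λ ω → X ω ℚ-Mult.× v ω + Y ω ℚ-Mult.× v ω)  ≡⟨ ℚ-Sum.∑-distrib-+ (λ ω → X ω ℚ-Mult.× v ω) (λ ω → Y ω ℚ-Mult.× v ω) ⟩
    ℚ-Sum.sum (λ ω → X ω ℚ-Mult.× v ω) + ℚ-Sum.sum (λ ω → Y ω ℚ-Mult.× v ω)
      ≡⟨ cong₂ _+_ (seq-mean X k) (seq-mean Y k) ⟨
    seq (mean w X) k + seq (mean w Y) k                    ∎
    where
    open ≡-Reasoning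
    v : Fin N → ℚ
    v ω = seq (w ω) k

  mean-cong : ∀ {X Y} → (∀ ω → X ω ≡ Y ω) → mean w X ≐ mean w Y
  mean-cong {X} {Y} eq k = trans (seq-mean X k) (trans
    (ℚ-Sum.sum-cong-≗ (λ ω → cong (ℚ-Mult._× seq (w ω) k) (eq ω))) (sym (seq-mean Y k)))

  mean-0 : mean w (λ _ → 0) ≐ 0ᵣ
  mean-0 k = trans (seq-mean (λ _ → 0) k) (ℚ-Sum.sum-replicate-zero N)

  mean-1 : mean w (λ _ → 1) ≐ ∑ᵣ w
  mean-1 k = trans (seq-mean (λ _ → 1) k) (trans
    (ℚ-Sum.sum-cong-≗ (λ ω → +-identityʳ (seq (w ω) k))) (sym (seq-∑ w k)))

  mean-const : ∀ n → mean w (λ _ → n) ≐ n ×ᵣ ∑ᵣ w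
  mean-const zero    k = mean-0 k
  mean-const (suc n) k = trans (mean-+ (λ _ → 1) (λ _ → n) k) (cong₂ _+_ (mean-1 k) (mean-const n k))

module _ {N} (w : Fin N → ℝ) (w≥0 : ∀ ω → 0ᵣ ≤ᵣ w ω) (∑w≈1 : ∑ᵣ w ≈ᵣ 1ᵣ) where

  indicator : (Fin N → Bool) → Fin N → ℕ
  indicator e ω = if e ω then 1 else 0

  -- The event and its complement have total mass 1, so the complement of a certain event has mass
  -- at most 0. That mass bounds the weight of each of its outcomes, all weights being nonnegative.
  certain⇒null : ∀ e → mean w (indicator e) ≈ᵣ 1ᵣ → ∀ ω → e ω ≡ false → w ω ≤ᵣ 0ᵣ
  certain⇒null e (_ , 1≤P) ω eω≡false = ≤ᵣ-trans (w ω) (indicator (not ∘ e) ω ×ᵣ w ω) 0ᵣ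
    (≐⇒≤ᵣ (w ω) (indicator (not ∘ e) ω ×ᵣ w ω)
      (subst (λ x → w ω ≐ ((if not x then 1 else 0) ×ᵣ w ω)) (sym eω≡false) (λ k → sym (+-identityʳ (seq (w ω) k)))))
    (≤ᵣ-trans (indicator (not ∘ e) ω ×ᵣ w ω) P̅ 0ᵣ
      (term≤∑ (λ ω → indicator (not ∘ e) ω ×ᵣ w ω) (λ ω → ×-monoˡ-≤ᵣ {0} {indicator (not ∘ e) ω} (w ω) (w≥0 ω) z≤n) ω)
      (+ᵣ-cancelˡ-≤ᵣ P P̅ 0ᵣ
        (≤ᵣ-trans (P +ᵣ P̅) (∑ᵣ w) (P +ᵣ 0ᵣ) (≐⇒≤ᵣ (P +ᵣ P̅) (∑ᵣ w) P+P̅≐∑w)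
          (≤ᵣ-trans (∑ᵣ w) 1ᵣ (P +ᵣ 0ᵣ) (proj₁ ∑w≈1)
            (≤ᵣ-trans 1ᵣ P (P +ᵣ 0ᵣ) 1≤P (≐⇒≤ᵣ P (P +ᵣ 0ᵣ) (λ k → sym (+-identityʳ (seq P k)))))))))
    where
    P P̅ : ℝ
    P = mean w (indicator e)
    P̅ = mean w (indicator (not ∘ e))
    one : ∀ x → 1 ≡ (if x then 1 else 0) ℕ.+ (if not x then 1 else 0)
    one true  = refl
    one false = refl
    P+P̅≐∑w : P +ᵣ P̅ ≐ ∑ᵣ w
    P+P̅≐∑w k = trans (sym (mean-+ w (indicator e) (indicator (not ∘ e)) k))
      (trans (sym (mean-cong w (λ ω → one (e ω)) k)) (mean-1 w k))

  -- An outcome of null weight contributes at most 0 to the mean of the constant `n` and at least 0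
  -- to that of `X`; elsewhere `n` is below `X`.
  mean-lower : ∀ X n → (∀ ω → n ℕ.≤ X ω ⊎ w ω ≤ᵣ 0ᵣ) → fromℚ (ι n) ≤ᵣ mean w X
  mean-lower X n le =
    ≤ᵣ-trans (fromℚ (ι n)) (n ×ᵣ 1ᵣ) (mean w X)
      (≐⇒≤ᵣ (fromℚ (ι n)) (n ×ᵣ 1ᵣ) (λ k → sym (trans (seq-× n 1ᵣ k) (trans (×≡ι* n 1ℚ) (*-identityʳ (ι n))))))
    (≤ᵣ-trans (n ×ᵣ 1ᵣ) (n ×ᵣ ∑ᵣ w) (mean w X) (×-monoʳ-≤ᵣ n 1ᵣ (∑ᵣ w) (proj₂ ∑w≈1))
    (≤ᵣ-trans (n ×ᵣ ∑ᵣ w) (mean w (λ _ → n)) (mean w X)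
      (≐⇒≥ᵣ (mean w (λ _ → n)) (n ×ᵣ ∑ᵣ w) (mean-const w n))
      (∑-mono-≤ᵣ (λ ω → n ×ᵣ w ω) (λ ω → X ω ×ᵣ w ω) term)))
    where
    term : ∀ ω → n ×ᵣ w ω ≤ᵣ X ω ×ᵣ w ω
    term ω with le ω
    ... | inj₁ n≤X = ×-monoˡ-≤ᵣ (w ω) (w≥0 ω) n≤X
    ... | inj₂ w≤0 = ≤ᵣ-trans (n ×ᵣ w ω) 0ᵣ (X ω ×ᵣ w ω)
      (≤ᵣ-trans (n ×ᵣ w ω) (n ×ᵣ 0ᵣ) 0ᵣ (×-monoʳ-≤ᵣ n (w ω) 0ᵣ w≤0) (≐⇒≤ᵣ (n ×ᵣ 0ᵣ) 0ᵣ (×-zeroʳ n)))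
      (×-monoˡ-≤ᵣ {0} {X ω} (w ω) (w≥0 ω) z≤n)

-- Expected costs

module _ {n} (R : LasVegasAlgorithm n) where
  open LasVegasAlgorithm R

  total-cost : ∀ {q} → cost q → ∀ bs → All Valid bs →
    Eventually λ k → seq (𝔼 λ ω → total (queries (algorithm ω)) bs) k ≤ ι (length bs) * q
  total-cost {q} c []       []       = 0 , λ k _ → ≤-reflexive (trans (mean-0 weight k) (sym (*-zeroˡ q)))
  total-cost {q} c (b ∷ bs) (v ∷ vs) =
    let r , r<q , E≤r = c b v in
    Eventually-map₂
      (λ {k} p p′ → subst₂ _≤_
        (sym (mean-+ weight (λ ω → queries (algorithm ω) b) (λ ω → total (queries (algorithm ω)) bs) k))
        (suc* (length bs))
        (+-mono-≤ (≤-trans p (<⇒≤ r<q)) p′))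
      E≤r (total-cost c bs vs)
    where
    suc* : ∀ m → q + ι m * q ≡ ι (suc m) * q
    suc* m = trans (cong (_+ ι m * q) (sym (*-identityˡ q)))
      (trans (sym (*-distribʳ-+ q 1ℚ (ι m))) (cong (_* q) (sym (ι-+ 1 m))))

  -- The averaging argument of Yao: the worst expected cost is at least the average over `bs`, and
  -- exchanging the two sums leaves a bound for each deterministic algorithm. Those that miss a
  -- valid input have null weight by `certain⇒null`.
  cost-lower : ∀ {q} → cost q → ∀ bs → All Valid bs → ∀ M →
    (∀ A → M ℕ.≤ total (queries A) bs ⊎ ∃[ b ] (Valid b × finds A b ≡ false)) →
    ι M ≤ ι (length bs) * q
  cost-lower {q} c bs vs M dichotomy = fromℚ-cancel-≤ᵣ λ ε 0<ε →
    Eventually-map₂ (λ p p′ → ≤-trans p (+-monoˡ-≤ ε p′))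
      (mean-lower weight weight≥0 weight-sum _ M case ε 0<ε)
      (total-cost c bs vs)
    where
    case : ∀ ω → M ℕ.≤ total (queries (algorithm ω)) bs ⊎ weight ω ≤ᵣ 0ᵣ
    case ω with dichotomy (algorithm ω)
    ... | inj₁ M≤             = inj₁ M≤
    ... | inj₂ (b , v , miss) = inj₂ (certain⇒null weight weight≥0 weight-sum
            (λ ω → finds (algorithm ω) b) (alwaysFinds b v) ω miss)

  cost-lower-root : ∀ m → 2 ℕ.* m ℕ.* (2 ℕ.* m) ℕ.≤ n → ∀ {q} → cost q → ι (m ℕ.* m) ≤ ι (2 ℕ.* m) * q
  cost-lower-root m 4m²≤n {q} c =
    let bs , length≡2m , valid , dichotomy = hardInputs n m 4m²≤n
    in subst (λ x → ι (m ℕ.* m) ≤ ι x * q) length≡2m (cost-lower c bs valid (m ℕ.* m) dichotomy)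

-- The lower bound

eighth : ℚ
eighth = ℤ.+ 1 / 8

-- With 4m² ≤ n < 4 (m + 1)² every cost bound satisfies q ≥ m / 2, so 8q ≥ 4m ≥ 2 (m + 1) > √n,
-- which puts 8q in the cut of √n.
Q-lower : ∀ n → 4 ℕ.≤ n → eighth ·ᵘ √ n ≤ᵘ Q n
Q-lower n 4≤n q (R , c) with integerRoot 2 n
... | m , lo , hi = ι 8 * q , (0<r , n<r²) ,
  ≤-reflexive (trans (sym (*-assoc eighth (ι 8) q)) (*-identityˡ q))
  where
  -- Here n ≥ 4 is used; 2 (m + 1) ≤ 4m fails for m = 0.
  1≤m : 1 ℕ.≤ m
  1≤m = pos m hi
    where
    pos : ∀ m → n ℕ.< 2 ℕ.* suc m ℕ.* (2 ℕ.* suc m) → 1 ℕ.≤ m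
    pos zero    n<4 = ⊥-elim (ℕ.<-irrefl refl (ℕ.<-≤-trans n<4 4≤n))
    pos (suc m) _   = s≤s z≤n
  instance
    m≢0 : NonZero m
    m≢0 = ℕ.>-nonZero 1≤m
    2m≢0 : NonZero (2 ℕ.* m)
    2m≢0 = ℕ.m*n≢0 2 m
    2+2m≢0 : NonZero (2 ℕ.* suc m)
    2+2m≢0 = ℕ.m*n≢0 2 (suc m)
  u : ℕ
  u = 2 ℕ.* suc m
  u≤r : ι u ≤ ι 8 * q
  u≤r = *-cancelˡ-≤-pos (ι (2 ℕ.* m)) {{ι-positive (2 ℕ.* m)}} (begin
    ι (2 ℕ.* m) * ι u            ≡⟨ ι-* (2 ℕ.* m) u ⟨
    ι (2 ℕ.* m ℕ.* u)            ≤⟨ ι-mono-≤ (ℕ.*-monoʳ-≤ (2 ℕ.* m) u≤4m) ⟩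
    ι (2 ℕ.* m ℕ.* (4 ℕ.* m))    ≡⟨ cong ι (lemma m) ⟩
    ι (8 ℕ.* (m ℕ.* m))          ≡⟨ ι-* 8 (m ℕ.* m) ⟩
    ι 8 * ι (m ℕ.* m)            ≤⟨ *-monoˡ-≤-nonNeg (ι 8) {{ι-nonNegative 8}} (cost-lower-root R m lo c) ⟩
    ι 8 * (ι (2 ℕ.* m) * q)      ≡⟨ trans (sym (*-assoc (ι 8) 2m q)) (trans (cong (_* q) (*-comm (ι 8) 2m)) (*-assoc 2m (ι 8) q)) ⟩
    ι (2 ℕ.* m) * (ι 8 * q)      ∎)
    where
    open ≤-Reasoning
    2m : ℚ
    2m = ι (2 ℕ.* m)
    lemma : ∀ m → 2 ℕ.* m ℕ.* (4 ℕ.* m) ≡ 8 ℕ.* (m ℕ.* m)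
    lemma = solve-∀
    lemma₂ : ∀ m → 2 ℕ.* (m ℕ.+ m) ≡ 4 ℕ.* m
    lemma₂ = solve-∀
    u≤4m : u ℕ.≤ 4 ℕ.* m
    u≤4m = ℕ.≤-trans (ℕ.*-monoʳ-≤ 2 (ℕ.+-monoˡ-≤ m 1≤m)) (ℕ.≤-reflexive (lemma₂ m))
  0<r : 0ℚ < ι 8 * q
  0<r = <-≤-trans (positive⁻¹ (ι u) {{ι-positive u}}) u≤r
  n<r² : ι n < ι 8 * q * (ι 8 * q)
  n<r² = <-≤-trans (subst (ι n <_) (ι-* u u) (ι-mono-< hi))
    (≤-trans (*-monoˡ-≤-nonNeg (ι u) {{ι-nonNegative u}} u≤r) (*-monoʳ-≤-nonNeg (ι 8 * q) {{nonNegative (<⇒≤ 0<r)}} u≤r))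

-- Uniform choice from a list of algorithms

mean-uniform : ∀ {a} {A : Set a} w (f : A → ℕ) (L : List A) k →
               seq (mean {length L} (λ _ → fromℚ w) (f ∘ lookup L)) k ≡ ι (total f L) * w
mean-uniform w f []      k = sym (*-zeroˡ w)
mean-uniform w f (x ∷ L) k = begin
  seq (f x ×ᵣ fromℚ w) k + seq (mean (λ _ → fromℚ w) (f ∘ lookup L)) k
    ≡⟨ cong₂ _+_ (trans (seq-× (f x) (fromℚ w) k) (×≡ι* (f x) w)) (mean-uniform w f L k) ⟩
  ι (f x) * w + ι (total f L) * w   ≡⟨ *-distribʳ-+ w (ι (f x)) (ι (total f L)) ⟨
  (ι (f x) + ι (total f L)) * w     ≡⟨ cong (_* w) (ι-+ (f x) (total f L)) ⟨
  ι (f x ℕ.+ total f L) * w ∎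
  where open ≡-Reasoning

module _ {n} (L : List (Algorithm n)) .{{L≢0 : NonZero (length L)}} where

  private
    instance
      ιN-positive : Positive (ι (length L))
      ιN-positive = ι-positive (length L)
      ιN-nonZero : ℚ.NonZero (ι (length L))
      ιN-nonZero = pos⇒nonZero (ι (length L))

  uniformWeight : ℚ
  uniformWeight = 1/ ι (length L)

  private
    w-nonNeg : NonNegative uniformWeight
    w-nonNeg = pos⇒nonNeg uniformWeight {{1/pos⇒pos (ι (length L))}}

    mean-1≐1ᵣ : mean {length L} (λ _ → fromℚ uniformWeight) (λ _ → 1) ≐ 1ᵣ
    mean-1≐1ᵣ k = trans (mean-uniform uniformWeight (λ _ → 1) L k)
      (trans (cong (λ x → ι x * uniformWeight) (total-1 L)) (*-inverseʳ (ι (length L))))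

  -- The outcomes are the positions in `L`, so repetitions in the list act as probabilities.
  uniform : RandomizedAlgorithm n
  uniform = record
    { size       = length L
    ; weight     = λ _ → fromℚ uniformWeight
    ; weight≥0   = λ _ ε 0<ε → 0 , λ _ _ → ≤-trans (nonNegative⁻¹ uniformWeight {{w-nonNeg}}) (p≤p+ε uniformWeight 0<ε)
    ; weight-sum = ≐⇒≈ᵣ ∑w 1ᵣ ∑w≐1ᵣ
    ; algorithm  = lookup L
    }
    where
    ∑w : ℝ
    ∑w = ∑ᵣ {length L} (λ _ → fromℚ uniformWeight)
    ∑w≐1ᵣ : ∑w ≐ 1ᵣ
    ∑w≐1ᵣ k = trans (sym (mean-1 {length L} (λ _ → fromℚ uniformWeight) k)) (mean-1≐1ᵣ k)

  uniformLasVegas : (∀ b → Valid b → All (λ A → finds A b ≡ true) L) → LasVegasAlgorithm n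
  uniformLasVegas allFind = record
    { randomized  = uniform
    ; alwaysFinds = λ b v → ≐⇒≈ᵣ (RandomizedAlgorithm.ℙ-finds uniform b) 1ᵣ (ℙ-finds≐1ᵣ b v)
    }
    where
    ℙ-finds≐1ᵣ : ∀ b → Valid b → RandomizedAlgorithm.ℙ-finds uniform b ≐ 1ᵣ
    ℙ-finds≐1ᵣ b v k = trans
      (mean-cong (λ _ → fromℚ uniformWeight) {λ ω → if finds (lookup L ω) b then 1 else 0}
        (λ ω → cong (λ x → if x then 1 else 0) (All.lookup (allFind b v) (∈-lookup ω))) k)
      (mean-1≐1ᵣ k)

  uniform-queries : ∀ b K → total (λ A → queries A b) L ℕ.≤ length L ℕ.* K →
                    ∀ k → seq (RandomizedAlgorithm.𝔼-queries uniform b) k ≤ ι K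
  uniform-queries b K T≤NK k = begin
    seq (RandomizedAlgorithm.𝔼-queries uniform b) k    ≡⟨ mean-uniform uniformWeight (λ A → queries A b) L k ⟩
    ι (total (λ A → queries A b) L) * uniformWeight    ≤⟨ *-monoʳ-≤-nonNeg uniformWeight {{w-nonNeg}} (ι-mono-≤ T≤NK) ⟩
    ι (length L ℕ.* K) * uniformWeight                 ≡⟨ cong (_* uniformWeight) (trans (cong ι (ℕ.*-comm (length L) K)) (ι-* K (length L))) ⟩
    ι K * ι (length L) * uniformWeight                 ≡⟨ *-assoc (ι K) (ι (length L)) uniformWeight ⟩
    ι K * (ι (length L) * uniformWeight)               ≡⟨ cong (ι K *_) (*-inverseʳ (ι (length L))) ⟩
    ι K * 1ℚ                                           ≡⟨ *-identityʳ (ι K) ⟩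
    ι K                                                ∎
    where open ≤-Reasoning

-- The upper bound

Q-upper-root : ∀ t h l → 2 ℕ.* h ℕ.< h ℕ.+ l → l ℕ.≤ 2 ℕ.+ h → h ℕ.≤ suc t ℕ.* (2 ℕ.+ suc t) →
  ∀ {q} → ι (6 ℕ.* suc t) < q → Q (h ℕ.+ l) q
Q-upper-root t h l 2h<n l≤2+h h≤ 6s<q =
  uniformLasVegas L (λ b v → sampling-finds t h l b (valid⇒ones 2h<n b v)) ,
  λ b v → ι (6 ℕ.* suc t) , 6s<q , 0 , λ k _ →
    uniform-queries L b (6 ℕ.* suc t) (sampling-total t h l 2h<n l≤2+h h≤ b v) k
  where
  L = sampling t h l
  instance
    L≢0 : NonZero (length L)
    L≢0 = subst NonZero (sym (length-sampling t h l)) (ℕ.m^n≢0 (suc t) h)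

Q-upper : ∀ n → 1 ℕ.≤ n → Q n ≤ᵘ ι 7 ·ᵘ √ n
-- The stream has length `suc n`, but its predecessor is halved: then 2h < suc n, so the first `h`
-- bits are too few to hold all ones of a valid input.
Q-upper (suc n) _ q (r , (0<r , n<r²) , 7r≤q) with integerRoot 1 (suc n) | halve n
... | zero  , _  , s≤s () | _
... | suc t , lo , hi | h , 2h≤n , n≤1+2h = subst (λ N → Q N q) split
  (Q-upper-root t h l (subst (2 ℕ.* h ℕ.<_) (sym split) (s≤s 2h≤n))
    (ℕ.+-cancelˡ-≤ h _ _ (ℕ.≤-trans (ℕ.≤-reflexive split) (ℕ.≤-trans (s≤s n≤1+2h) (ℕ.≤-reflexive (lemma h)))))
    (ℕ.≤-trans (ℕ.m≤n⇒m≤1+n (ℕ.≤-trans (ℕ.m≤m+n h _) 2h≤n))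
      (s≤s⁻¹ (ℕ.≤-trans hi (ℕ.≤-reflexive (lemma₂ t)))))
    6s<q)
  where
  l = suc n ℕ.∸ h
  split : h ℕ.+ l ≡ suc n
  split = ℕ.m+[n∸m]≡n (ℕ.m≤n⇒m≤1+n (ℕ.≤-trans (ℕ.m≤m+n h _) 2h≤n))
  lemma : ∀ h → 2 ℕ.+ 2 ℕ.* h ≡ h ℕ.+ (2 ℕ.+ h)
  lemma = solve-∀
  lemma₂ : ∀ t → 1 ℕ.* (2 ℕ.+ t) ℕ.* (1 ℕ.* (2 ℕ.+ t)) ≡ 1 ℕ.+ (1 ℕ.+ t) ℕ.* (3 ℕ.+ t)
  lemma₂ = solve-∀
  -- With s = 1 + t the root gives s² ≤ suc n < r². The strict inequality is what membership in an
  -- upper cut requires.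
  s<r : ι (suc t) < r
  s<r = ≰⇒> λ r≤s → <-irrefl refl (<-≤-trans n<r² (begin
    r * r                       ≤⟨ *-monoˡ-≤-nonNeg r {{nonNegative (<⇒≤ 0<r)}} r≤s ⟩
    r * ι (suc t)               ≤⟨ *-monoʳ-≤-nonNeg (ι (suc t)) {{ι-nonNegative (suc t)}} r≤s ⟩
    ι (suc t) * ι (suc t)       ≡⟨ ι-* (suc t) (suc t) ⟨
    ι (suc t ℕ.* suc t)         ≤⟨ ι-mono-≤ (subst (λ x → x ℕ.* x ℕ.≤ suc n) (ℕ.*-identityˡ (suc t)) lo) ⟩
    ι (suc n)                   ∎))
    where open ≤-Reasoning
  6s<q : ι (6 ℕ.* suc t) < q
  6s<q = <-≤-trans (≤-<-trans (ι-mono-≤ (ℕ.*-monoˡ-≤ (suc t) (ℕ.n≤1+n 6)))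
    (subst (_< ι 7 * r) (sym (ι-* 7 (suc t))) (*-monoʳ-<-pos (ι 7) {{ι-positive 7}} s<r))) 7r≤q

theorem1 : IsΘ Q √
theorem1 = eighth , ι 7 , positive⁻¹ eighth , positive⁻¹ (ι 7) , 4 , λ n 4≤n →
  Q-lower n 4≤n , Q-upper n (ℕ.≤-trans (s≤s z≤n) 4≤n)
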